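{- Let $n,a,b,r$ be positive integers with $n\ge a+b$, and let $\mathcal A\subset\binom{[n]}{a}$, $\mathcal B\subset\binom{[n]}{b}$ be cross-intersecting. Suppose one of the following holds: (i) $a<b$ and $|\mathcal A|\ge r$; (ii) $a=b$ and $|\mathcal A|,|\mathcal B|\ge r$; (iii) $a>b$, $|\mathcal A|\ge r$ and $|\mathcal B|\ge\binom{n}{b}-\binom{n-a+b}{b}+r$. Then for $1\le r\le b-1$, \[ |\mathcal A|+|\mathcal B|\le\binom{n}{b}-\binom{n-a+1}{b}+\binom{n-a-r+1}{b-r}+r, \] and for $b\le r\le n-a+1$, \[ |\mathcal A|+|\mathcal B|\le\binom{n}{b}-\binom{n-a+1}{b}+n-a+1. \]
   Context: $\mathcal A,\mathcal B$ are cross-intersecting if $A\cap B\ne\emptyset$ for all $A\in\mathcal A$, $B\in\mathcal B$. Binomial coefficients $\binom{m}{j}$ are $0$ when $j<0$ or $j>m$. -}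

module Defs where

open import Data.Nat using (ℕ)
open import Data.List using (List; length)
open import Data.List.Membership.Propositional using (_∈_)
open import Data.List.Relation.Unary.All using (All)
open import Data.List.Relation.Unary.Unique.Propositional using (Unique)
open import Data.Fin.Subset using (Subset; ∣_∣; _∩_; Nonempty)
open import Data.Product using (_×_)
open import Relation.Binary.PropositionalEquality using (_≡_)

-- A family of k-subsets of [n] = {0,…,n-1}: a duplicate-free list of
-- subsets, each of cardinality k.  Its size |𝓕| is the list length.
IsUniformFamily : (n k : ℕ) → List (Subset n) → Set
IsUniformFamily n k 𝓕 = Unique 𝓕 × All (λ A → ∣ A ∣ ≡ k) 𝓕

CrossIntersecting : {n : ℕ} → List (Subset n) → List (Subset n) → Set
CrossIntersecting 𝓐 𝓑 = ∀ {A B} → A ∈ 𝓐 → B ∈ 𝓑 → Nonempty (A ∩ B)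

{-# OPTIONS --safe #-}
-- By the Kruskal–Katona theorem in Hilton's form, 𝓐 and 𝓑 may be replaced by the lexicographic
-- initial segments of the same sizes.  It is proved by Frankl's method: shift both families away
-- from one point until stable, and note that a stable family has at least as many members avoiding
-- that point as the lexicographic segment of the same size.
--
-- For lexicographic segments and a < b, either 𝓐 lies in the star of the first point, which may then
-- be deleted, or 𝓑 does, and then the sum is compared with that of a full star.  The cases a = b and
-- a > b reduce to this one by deleting points contained in all members of one of the families.
module Submission where

open import Defs
open import Data.Nat using (ℕ; zero; suc; _+_; _∸_; _≤_; _<_; _>_; z≤n; s≤s; s≤s⁻¹; _≤?_; _≡ᵇ_)
open import Data.Nat.Properties
open import Data.Nat.Combinatorics using (_C_; nCk≡nC[n∸k]; nCn≡1; nC1≡n; nCk+nC[k+1]≡[n+1]C[k+1])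
open import Data.Nat.Induction using (<-wellFounded)
open import Data.Nat.Tactic.RingSolver using (solve-∀)
open import Data.Bool using (Bool; true; false; not; _∧_; _∨_; if_then_else_) renaming (_≟_ to _≟ᵇ_)
open import Data.Fin using (Fin; zero; suc)
open import Data.Fin.Properties using (all?; ¬∀⟶∃¬) renaming (_≟_ to _≟ᶠ_)
open import Data.Fin.Subset using (Subset; ∣_∣; ∁)
open import Data.Fin.Subset.Properties using (x∈p∩q⁻)
open import Data.List using (List; []; _∷_; length)
open import Data.List.Membership.Propositional using (_∈_)
open import Data.List.Relation.Unary.All as All using ()
open import Data.List.Relation.Unary.AllPairs using (_∷_)
open import Data.List.Relation.Unary.Any using (here; there)
open import Data.List.Relation.Unary.Unique.Propositional using (Unique)
open import Data.Product using (_×_; _,_; proj₁; proj₂; ∃)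
open import Data.Sum using (_⊎_; inj₁; inj₂) renaming (map₂ to ⊎-map₂; map to ⊎-map)
open import Data.Vec using ([]; _∷_; lookup; _[_]≔_)
open import Data.Vec.Properties using (lookup∘update; lookup∘update′; lookup-map; []=⇒lookup; ≡-dec)
open import Function using (_∘_)
open import Induction.WellFounded using (Acc; acc)
open import Relation.Nullary using (¬_; Dec; does; yes; no; contradiction)
open import Relation.Nullary.Decidable using (dec-true)
open import Relation.Binary.PropositionalEquality using (_≡_; refl; sym; trans; cong; cong₂; subst; subst₂)

open ≤-Reasoning

-- No lexicographic segment is ever built: `LexCross` and `lexDelete` are recursions on sizes, so
-- the extremal analysis is arithmetic of binomial coefficients. Frankl's counting step invokes the
-- theorem being proved, on one point fewer, for an auxiliary pair: the sets that lose the vacated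
-- point, and the complements of the missing sets. Losing a point requires a + b < n, so a + b = n
-- is settled separately by pairing each set with its complement. In the bound, deleting the first
-- point from 𝓐 lowers n and a together. Hence m = n - a is the stable parameter, and the subtracted
-- binomial coefficient stands on the left to avoid truncated subtraction.

+-swapʳ : ∀ x y z → x + y + z ≡ x + z + y
+-swapʳ = solve-∀

+-left-comm : ∀ x y z → x + (y + z) ≡ y + (x + z)
+-left-comm = solve-∀

+-interchange : ∀ w x y z → (w + x) + (y + z) ≡ (w + y) + (x + z)
+-interchange = solve-∀

-- Binomial coefficients

pascal : ∀ n k → suc n C suc k ≡ n C k + n C suc k
pascal n k = sym (nCk+nC[k+1]≡[n+1]C[k+1] n k)

nC0≡1 : ∀ n → n C 0 ≡ 1
nC0≡1 n = trans (nCk≡nC[n∸k] {0} {n} z≤n) (nCn≡1 n)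

C-sym : ∀ {n} k l → k + l ≡ n → n C k ≡ n C l
C-sym k l refl = trans (nCk≡nC[n∸k] (m≤m+n k l)) (cong ((k + l) C_) (m+n∸m≡n k l))

C-positive : ∀ n k → k ≤ n → 1 ≤ n C k
C-positive n zero _ = ≤-reflexive (sym (nC0≡1 n))
C-positive (suc n) (suc k) (s≤s k≤n) = begin
  1                  ≤⟨ C-positive n k k≤n ⟩
  n C k              ≤⟨ m≤m+n (n C k) (n C suc k) ⟩
  n C k + n C suc k  ≡⟨ pascal n k ⟨
  suc n C suc k      ∎

C-monoˡ-suc : ∀ n k → n C k ≤ suc n C k
C-monoˡ-suc n zero = ≤-reflexive (trans (nC0≡1 n) (sym (nC0≡1 (suc n))))
C-monoˡ-suc n (suc k) = begin
  n C suc k          ≤⟨ m≤n+m (n C suc k) (n C k) ⟩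
  n C k + n C suc k  ≡⟨ pascal n k ⟨
  suc n C suc k      ∎

C-monoˡ : ∀ j n k → n C k ≤ (j + n) C k
C-monoˡ zero n k = ≤-refl
C-monoˡ (suc j) n k = ≤-trans (C-monoˡ j n k) (C-monoˡ-suc (j + n) k)

-- Unimodality.  Pairing the Pascal summands crosswise keeps k + l ≤ n in both recursive calls.
C-monoʳ : ∀ n k l → k ≤ l → k + l ≤ n → n C k ≤ n C l
C-monoʳ n zero l _ l≤n = subst (_≤ n C l) (sym (nC0≡1 n)) (C-positive n l l≤n)
C-monoʳ (suc n) (suc k) (suc l) (s≤s k≤l) (s≤s k+1+l≤n) with m≤n⇒m<n∨m≡n k≤l
... | inj₂ refl = ≤-refl
... | inj₁ k<l  = begin
  suc n C suc k      ≡⟨ pascal n k ⟩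
  n C k + n C suc k  ≤⟨ +-mono-≤ (C-monoʳ n k (suc l) (m≤n⇒m≤1+n k≤l) k+1+l≤n)
                                 (C-monoʳ n (suc k) l k<l (subst (_≤ n) (+-suc k l) k+1+l≤n)) ⟩
  n C suc l + n C l  ≡⟨ +-comm (n C suc l) (n C l) ⟩
  n C l + n C suc l  ≡⟨ pascal n l ⟨
  suc n C suc l      ∎

∸-bound-C : ∀ n k {x} → x ≤ suc n C suc k → x ∸ n C k ≤ n C suc k
∸-bound-C n k {x} x≤ = m≤n+o⇒m∸n≤o x (n C k) (subst (x ≤_) (pascal n k) x≤)

-- The cross-intersection relation of lexicographic initial segments

-- LexCross n a b x y: for a + b ≤ n, the first x sets of ([n] choose a) and the first y sets of
-- ([n] choose b) in lexicographic order cross-intersect.  The sets containing the first point come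
-- first, and one of the two segments has to stay inside that star.
LexCross : (n a b x y : ℕ) → Set
LexCross n zero b x y = x ≡ 0 ⊎ y ≡ 0
LexCross n (suc a) zero x y = x ≡ 0 ⊎ y ≡ 0
LexCross zero (suc a) (suc b) x y = x ≡ 0 ⊎ y ≡ 0
LexCross (suc n) (suc a) (suc b) x y =
    (x ≤ n C a × LexCross n a (suc b) x (y ∸ n C b))
  ⊎ (y ≤ n C b × LexCross n (suc a) b (x ∸ n C a) y)

swap-zero : ∀ {x y : ℕ} → x ≡ 0 ⊎ y ≡ 0 → y ≡ 0 ⊎ x ≡ 0
swap-zero (inj₁ p) = inj₂ p
swap-zero (inj₂ p) = inj₁ p

LexCross-sym : ∀ n a b {x y} → LexCross n a b x y → LexCross n b a y x
LexCross-sym n zero zero p = swap-zero p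
LexCross-sym n zero (suc b) p = swap-zero p
LexCross-sym n (suc a) zero p = swap-zero p
LexCross-sym zero (suc a) (suc b) p = swap-zero p
LexCross-sym (suc n) (suc a) (suc b) (inj₁ (p , q)) = inj₂ (p , LexCross-sym n a (suc b) q)
LexCross-sym (suc n) (suc a) (suc b) (inj₂ (p , q)) = inj₁ (p , LexCross-sym n (suc a) b q)

LexCross-zeroʳ : ∀ n a b x → LexCross n a b x 0
LexCross-zeroʳ n zero b x = inj₂ refl
LexCross-zeroʳ n (suc a) zero x = inj₂ refl
LexCross-zeroʳ zero (suc a) (suc b) x = inj₂ refl
LexCross-zeroʳ (suc n) (suc a) (suc b) x = inj₂ (z≤n , LexCross-zeroʳ n (suc a) b (x ∸ n C a))

antitone-zero : ∀ {x y x′ y′} → x′ ≤ x → y′ ≤ y → x ≡ 0 ⊎ y ≡ 0 → x′ ≡ 0 ⊎ y′ ≡ 0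
antitone-zero p q (inj₁ refl) = inj₁ (n≤0⇒n≡0 p)
antitone-zero p q (inj₂ refl) = inj₂ (n≤0⇒n≡0 q)

LexCross-antitone : ∀ n a b {x y x′ y′} → x′ ≤ x → y′ ≤ y → LexCross n a b x y → LexCross n a b x′ y′
LexCross-antitone n zero b p q h = antitone-zero p q h
LexCross-antitone n (suc a) zero p q h = antitone-zero p q h
LexCross-antitone zero (suc a) (suc b) p q h = antitone-zero p q h
LexCross-antitone (suc n) (suc a) (suc b) p q (inj₁ (l , h)) =
  inj₁ (≤-trans p l , LexCross-antitone n a (suc b) p (∸-monoˡ-≤ (n C b) q) h)
LexCross-antitone (suc n) (suc a) (suc b) p q (inj₂ (l , h)) =
  inj₂ (≤-trans q l , LexCross-antitone n (suc a) b (∸-monoˡ-≤ (n C a) p) q h)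

LexCross-stars : ∀ n a b {x y} → x ≤ n C a → y ≤ n C b → LexCross (suc n) (suc a) (suc b) x y
LexCross-stars n a b {x} {y} x≤ y≤ =
  inj₁ (x≤ , subst (LexCross n a (suc b) x) (sym (m≤n⇒m∸n≡0 y≤)) (LexCross-zeroʳ n a (suc b) x))

-- For a + b = n the only b-set that an a-set fails to meet is its complement. Complementation
-- reverses the lexicographic order, so it sends the first y b-sets to the last y a-sets, and the
-- two segments cross as long as these do not overlap the first x.
LexCross-complementary : ∀ n a b {x y} → a + b ≡ n → x + y ≤ n C a → LexCross n a b x y
LexCross-complementary n zero b {zero} _ _ = inj₁ refl
LexCross-complementary n zero b {suc x} {y} _ h =
  inj₂ (n≤0⇒n≡0 (≤-trans (m≤n+m y x) (s≤s⁻¹ (≤-trans h (≤-reflexive (nC0≡1 n))))))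
LexCross-complementary n (suc a) zero {zero} _ _ = inj₁ refl
LexCross-complementary n (suc a) zero {suc x} {y} e h =
  inj₂ (n≤0⇒n≡0 (≤-trans (m≤n+m y x)
    (s≤s⁻¹ (≤-trans h (≤-reflexive (trans (C-sym (suc a) 0 e) (nC0≡1 n)))))))
LexCross-complementary (suc n) (suc a) (suc b) {x} {y} e h with x ≤? n C a | y ≤? n C b
... | yes x≤ | yes y≤ = LexCross-stars n a b x≤ y≤
... | yes x≤ | no y≰  = inj₁ (x≤ , LexCross-complementary n a (suc b) e′ (begin
  x + (y ∸ n C b)  ≡⟨ +-∸-assoc x (<⇒≤ (≰⇒> y≰)) ⟨
  x + y ∸ n C b    ≤⟨ m≤n+o⇒m∸n≤o (x + y) (n C b) h′ ⟩
  n C a            ∎))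
  where
  e′ = suc-injective e
  h′ : x + y ≤ n C b + n C a
  h′ = begin
    x + y              ≤⟨ h ⟩
    suc n C suc a      ≡⟨ pascal n a ⟩
    n C a + n C suc a  ≡⟨ cong (n C a +_) (C-sym (suc a) b (trans (sym (+-suc a b)) e′)) ⟩
    n C a + n C b      ≡⟨ +-comm (n C a) (n C b) ⟩
    n C b + n C a      ∎
... | no x≰  | yes y≤ = inj₂ (y≤ , LexCross-complementary n (suc a) b (trans (sym (+-suc a b)) (suc-injective e)) (begin
  (x ∸ n C a) + y  ≡⟨ +-∸-comm y (<⇒≤ (≰⇒> x≰)) ⟨
  x + y ∸ n C a    ≤⟨ m≤n+o⇒m∸n≤o (x + y) (n C a) (≤-trans h (≤-reflexive (pascal n a))) ⟩
  n C suc a        ∎))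
... | no x≰  | no y≰  = contradiction (begin-strict
  n C a + n C b      <⟨ +-mono-< (≰⇒> x≰) (≰⇒> y≰) ⟩
  x + y              ≤⟨ h ⟩
  suc n C suc a      ≡⟨ pascal n a ⟩
  n C a + n C suc a  ≡⟨ cong (n C a +_) (C-sym (suc a) b (trans (sym (+-suc a b)) (suc-injective e))) ⟩
  n C a + n C b      ∎) (<-irrefl refl)

-- lexDelete n a x is the number of sets avoiding the last point of [n+1] among the first x sets
-- of ([n+1] choose a) in lexicographic order.
lexDelete : (n a x : ℕ) → ℕ
lexDelete n zero x = x
lexDelete zero (suc a) x = 0
lexDelete (suc n) (suc a) x with x ≤? suc n C a
... | yes _ = lexDelete n a x
... | no _  = n C a + lexDelete n (suc a) (x ∸ suc n C a)

lexDelete-≤ : ∀ n a x → lexDelete n a x ≤ x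
lexDelete-≤ n zero x = ≤-refl
lexDelete-≤ zero (suc a) x = z≤n
lexDelete-≤ (suc n) (suc a) x with x ≤? suc n C a
... | yes _ = lexDelete-≤ n a x
... | no x≰ = begin
  n C a + lexDelete n (suc a) (x ∸ suc n C a)  ≤⟨ +-mono-≤ (C-monoˡ-suc n a) (lexDelete-≤ n (suc a) _) ⟩
  suc n C a + (x ∸ suc n C a)                  ≡⟨ m+[n∸m]≡n (<⇒≤ (≰⇒> x≰)) ⟩
  x                                            ∎

lexDelete-≤-C : ∀ n a x → x ≤ suc n C a → lexDelete n a x ≤ n C a
lexDelete-≤-C n zero x x≤ = ≤-trans x≤ (≤-reflexive (trans (nC0≡1 (suc n)) (sym (nC0≡1 n))))
lexDelete-≤-C zero (suc a) x x≤ = z≤n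
lexDelete-≤-C (suc n) (suc a) x x≤ with x ≤? suc n C a
... | yes x≤′ = begin
  lexDelete n a x    ≤⟨ lexDelete-≤-C n a x x≤′ ⟩
  n C a              ≤⟨ m≤m+n (n C a) (n C suc a) ⟩
  n C a + n C suc a  ≡⟨ pascal n a ⟨
  suc n C suc a      ∎
... | no _ = begin
  n C a + lexDelete n (suc a) (x ∸ suc n C a)  ≤⟨ +-monoʳ-≤ (n C a) (lexDelete-≤-C n (suc a) _ (∸-bound-C (suc n) a x≤)) ⟩
  n C a + n C suc a                            ≡⟨ pascal n a ⟨
  suc n C suc a                                ∎

-- The lexicographically first a-set consists of the first a points, and a ≤ n keeps the last point
-- of [n+1] out of it.
lexDelete-positive : ∀ n a x → a ≤ n → 1 ≤ x → 1 ≤ lexDelete n a x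
lexDelete-positive n zero x _ 1≤x = 1≤x
lexDelete-positive (suc n) (suc a) x (s≤s a≤n) 1≤x with x ≤? suc n C a
... | yes _ = lexDelete-positive n a x a≤n 1≤x
... | no _  = ≤-trans (C-positive n a a≤n) (m≤m+n (n C a) _)

lexDelete-degenerate : ∀ n a {z u v} → z ≤ n C a → u ≤ n C suc a → n C suc a ≤ v + u → z ≡ 0 ⊎ v ≡ 0 →
  lexDelete n (suc a) (z + u) ≤ u
lexDelete-degenerate n a {u = u} _ _ _ (inj₁ refl) = lexDelete-≤ n (suc a) u
lexDelete-degenerate n a z≤ u≤ vu (inj₂ refl) =
  ≤-trans (lexDelete-≤-C n (suc a) _ (≤-trans (+-mono-≤ z≤ u≤) (≤-reflexive (sym (pascal n a))))) vu

-- Frankl's counting step.  For a family of (a+1)-sets in [n+1] stable under replacing the last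
-- point, z and u count the members containing and avoiding it; the a-sets of the first kind
-- cross-intersect the complements of the (a+1)-sets of [n] missing from the second kind.
lexDelete-≤-avoiding : ∀ n a c {z u v} → suc (a + c) ≡ n → z ≤ n C a → u ≤ n C suc a →
  n C suc a ≤ v + u → LexCross n a c z v → lexDelete n (suc a) (z + u) ≤ u
lexDelete-≤-avoiding n zero c _ z≤ u≤ vu h = lexDelete-degenerate n zero z≤ u≤ vu h
lexDelete-≤-avoiding n (suc a) zero _ z≤ u≤ vu h = lexDelete-degenerate n (suc a) z≤ u≤ vu h
lexDelete-≤-avoiding (suc n) (suc a) (suc c) {z} {u} {v} e z≤ u≤ vu h = split h
  where
  e′ : suc (suc a + c) ≡ n
  e′ = trans (cong suc (sym (+-suc a c))) (suc-injective e)

  C-c : n C suc (suc a) ≡ n C c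
  C-c = C-sym (suc (suc a)) c e′

  -- Splitting `vu` by Pascal shows that v ≤ C(n, c) forces C(n, a+1) ≤ u; the branches where
  -- `LexCross` confines v to its star rest on this.
  vu′ : n C c + n C suc a ≤ v + u
  vu′ = begin
    n C c + n C suc a              ≡⟨ +-comm (n C c) (n C suc a) ⟩
    n C suc a + n C c              ≡⟨ cong (n C suc a +_) C-c ⟨
    n C suc a + n C suc (suc a)    ≡⟨ pascal n (suc a) ⟨
    suc n C suc (suc a)            ≤⟨ vu ⟩
    v + u                          ∎

  split : LexCross (suc n) (suc a) (suc c) z v → lexDelete (suc n) (suc (suc a)) (z + u) ≤ u
  split h with z + u ≤? suc n C suc a | h
  ... | yes x≤ | inj₂ (v≤ , _) = ≤-trans (lexDelete-≤-C n (suc a) (z + u) x≤)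
    (+-cancelˡ-≤ (n C c) _ _ (≤-trans vu′ (+-monoˡ-≤ u v≤)))
  ... | yes x≤ | inj₁ (z≤′ , h′) with u ≤? n C suc a
  ...   | no u≰   = ≤-trans (lexDelete-≤-C n (suc a) (z + u) x≤) (<⇒≤ (≰⇒> u≰))
  ...   | yes u≤′ = lexDelete-≤-avoiding n a (suc c) (suc-injective e) z≤′ u≤′
    (+-cancelˡ-≤ (n C c) _ _ (begin
      n C c + n C suc a            ≤⟨ vu′ ⟩
      v + u                        ≤⟨ +-monoˡ-≤ u (m≤n+m∸n v (n C c)) ⟩
      n C c + (v ∸ n C c) + u      ≡⟨ +-assoc (n C c) (v ∸ n C c) u ⟩
      n C c + ((v ∸ n C c) + u)    ∎)) h′
  -- Here z fits into a star of size C(n, a), so even the trivial bound `lexDelete-≤` on the part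
  -- beyond the star is enough.
  split h | no x≰ | inj₁ (z≤′ , _) = begin
    n C suc a + lexDelete n (suc (suc a)) (z + u ∸ suc n C suc a)
      ≤⟨ +-monoʳ-≤ (n C suc a) (lexDelete-≤ n (suc (suc a)) _) ⟩
    n C suc a + (z + u ∸ suc n C suc a)
      ≤⟨ +-monoʳ-≤ (n C suc a) (∸-mono (+-monoˡ-≤ u z≤′) (≤-reflexive (sym (pascal n a)))) ⟩
    n C suc a + ((n C a + u) ∸ (n C a + n C suc a))
      ≡⟨ cong (n C suc a +_) ([m+n]∸[m+o]≡n∸o (n C a) u (n C suc a)) ⟩
    n C suc a + (u ∸ n C suc a)
      ≡⟨ m+[n∸m]≡n (+-cancelˡ-≤ (n C a) _ _ (begin
           n C a + n C suc a  ≡⟨ pascal n a ⟨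
           suc n C suc a      ≤⟨ <⇒≤ (≰⇒> x≰) ⟩
           z + u              ≤⟨ +-monoˡ-≤ u z≤′ ⟩
           n C a + u          ∎)) ⟩
    u ∎
  split h | no x≰ | inj₂ (v≤ , h′) = begin
    n C suc a + lexDelete n (suc (suc a)) (z + u ∸ suc n C suc a)  ≤⟨ +-monoʳ-≤ (n C suc a) rest ⟩
    n C suc a + (u ∸ n C suc a)                                    ≡⟨ m+[n∸m]≡n C≤u ⟩
    u                                                              ∎
    where
    C≤u : n C suc a ≤ u
    C≤u = +-cancelˡ-≤ (n C c) _ _ (≤-trans vu′ (+-monoˡ-≤ u v≤))

    rest : lexDelete n (suc (suc a)) (z + u ∸ suc n C suc a) ≤ u ∸ n C suc a
    -- The recursion removes a full star from both z and u. If z is too small for that, the trivial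
    -- bound suffices again.
    rest with n C a ≤? z
    ... | no z≱ = ≤-trans (lexDelete-≤ n (suc (suc a)) _) (begin
      z + u ∸ suc n C suc a              ≤⟨ ∸-mono (+-monoˡ-≤ u (<⇒≤ (≰⇒> z≱))) (≤-reflexive (sym (pascal n a))) ⟩
      (n C a + u) ∸ (n C a + n C suc a)  ≡⟨ [m+n]∸[m+o]≡n∸o (n C a) u (n C suc a) ⟩
      u ∸ n C suc a                      ∎)
    ... | yes C≤z = subst (λ w → lexDelete n (suc (suc a)) w ≤ u ∸ n C suc a) (sym eq)
      (lexDelete-≤-avoiding n (suc a) c e′ (∸-bound-C n a z≤) (∸-bound-C n (suc a) u≤)
        (+-cancelˡ-≤ (n C suc a) _ _ (begin
          n C suc a + n C suc (suc a)    ≡⟨ pascal n (suc a) ⟨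
          suc n C suc (suc a)            ≤⟨ vu ⟩
          v + u                          ≡⟨ cong (v +_) (m+[n∸m]≡n C≤u) ⟨
          v + (n C suc a + (u ∸ n C suc a))  ≡⟨ +-left-comm v (n C suc a) _ ⟩
          n C suc a + (v + (u ∸ n C suc a))  ∎)) h′)
      where
      eq : z + u ∸ suc n C suc a ≡ (z ∸ n C a) + (u ∸ n C suc a)
      eq = begin-equality
        z + u ∸ suc n C suc a              ≡⟨ cong (z + u ∸_) (pascal n a) ⟩
        z + u ∸ (n C a + n C suc a)        ≡⟨ ∸-+-assoc (z + u) (n C a) (n C suc a) ⟨
        z + u ∸ n C a ∸ n C suc a          ≡⟨ cong (_∸ n C suc a) (+-∸-comm u C≤z) ⟩
        (z ∸ n C a) + u ∸ n C suc a        ≡⟨ +-∸-assoc (z ∸ n C a) C≤u ⟩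
        (z ∸ n C a) + (u ∸ n C suc a)      ∎

-- A segment that leaves the star of the first point still leaves it once the last point is deleted:
-- its first set outside the star avoids the last point.
exceeds-star : ∀ n a x → suc a ≤ n → ¬ (x ≤ suc n C a) →
  ¬ (n C a + lexDelete n (suc a) (x ∸ suc n C a) ≤ n C a)
exceeds-star n a x a<n x≰ l = <⇒≱ (m<m+n (n C a)
  (lexDelete-positive n (suc a) _ a<n (m<n⇒0<n∸m (≰⇒> x≰)))) l

-- Deleting the last point does not change which segments leave the star of the first point, so the
-- two relations unfold along the same branch.
LexCross-lift : ∀ n a b x y → a + b ≤ n →
  LexCross n a b (lexDelete n a x) (lexDelete n b y) → LexCross (suc n) a b x y
LexCross-lift n zero b x y b≤n (inj₁ p) = inj₁ p
LexCross-lift n zero b x zero b≤n (inj₂ _) = inj₂ refl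
LexCross-lift n zero b x (suc y) b≤n (inj₂ q) =
  contradiction (subst (1 ≤_) q (lexDelete-positive n b (suc y) b≤n (s≤s z≤n))) λ ()
LexCross-lift n (suc a) zero x y _ (inj₂ q) = inj₂ q
LexCross-lift n (suc a) zero zero y _ (inj₁ _) = inj₁ refl
LexCross-lift n (suc a) zero (suc x) y a≤n (inj₁ p) =
  contradiction (subst (1 ≤_) p (lexDelete-positive n (suc a) (suc x) (subst (_≤ n) (+-identityʳ (suc a)) a≤n) (s≤s z≤n))) λ ()
LexCross-lift (suc n) (suc a) (suc b) x y (s≤s a+1+b≤n) h with x ≤? suc n C a | y ≤? suc n C b
... | yes x≤ | yes y≤ = LexCross-stars (suc n) a b x≤ y≤
... | yes x≤ | no y≰ = case h
  where
  case : LexCross (suc n) (suc a) (suc b) (lexDelete n a x) (n C b + lexDelete n (suc b) (y ∸ suc n C b)) →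
         LexCross (suc (suc n)) (suc a) (suc b) x y
  case (inj₁ (_ , h′)) = inj₁ (x≤ , LexCross-lift n a (suc b) x (y ∸ suc n C b) a+1+b≤n
    (subst (LexCross n a (suc b) _) (m+n∸m≡n (n C b) _) h′))
  case (inj₂ (l , _)) = contradiction l (exceeds-star n b y (m+n≤o⇒n≤o a a+1+b≤n) y≰)
... | no x≰ | yes y≤ = case h
  where
  a+1≤n : suc a ≤ n
  a+1≤n = m+n≤o⇒m≤o (suc a) (subst (_≤ n) (+-suc a b) a+1+b≤n)

  case : LexCross (suc n) (suc a) (suc b) (n C a + lexDelete n (suc a) (x ∸ suc n C a)) (lexDelete n b y) →
         LexCross (suc (suc n)) (suc a) (suc b) x y
  case (inj₁ (l , _)) = contradiction l (exceeds-star n a x a+1≤n x≰)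
  case (inj₂ (_ , h′)) = inj₂ (y≤ , LexCross-lift n (suc a) b (x ∸ suc n C a) y (subst (_≤ n) (+-suc a b) a+1+b≤n)
    (subst (λ w → LexCross n (suc a) b w _) (m+n∸m≡n (n C a) _) h′))
... | no x≰ | no y≰ = case h
  where
  a+1≤n : suc a ≤ n
  a+1≤n = m+n≤o⇒m≤o (suc a) (subst (_≤ n) (+-suc a b) a+1+b≤n)

  case : LexCross (suc n) (suc a) (suc b) (n C a + lexDelete n (suc a) (x ∸ suc n C a))
           (n C b + lexDelete n (suc b) (y ∸ suc n C b)) →
         LexCross (suc (suc n)) (suc a) (suc b) x y
  case (inj₁ (l , _)) = contradiction l (exceeds-star n a x a+1≤n x≰)
  case (inj₂ (l , _)) = contradiction l (exceeds-star n b y (m+n≤o⇒n≤o a a+1+b≤n) y≰)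

-- Extremal sums for lexicographic segments

LexCross⇒sum-≤ : ∀ n a b {x y} → a ≤ b → a + b ≤ n → x ≤ n C a → y ≤ n C b →
  LexCross n a b x y → x + y ≤ n C b
LexCross⇒sum-≤ n zero b _ b≤n x≤ y≤ (inj₁ refl) = y≤
LexCross⇒sum-≤ n zero b {x} _ b≤n x≤ y≤ (inj₂ refl) = begin
  x + 0    ≡⟨ +-identityʳ x ⟩
  x        ≤⟨ x≤ ⟩
  n C 0    ≡⟨ nC0≡1 n ⟩
  1        ≤⟨ C-positive n b b≤n ⟩
  n C b    ∎
LexCross⇒sum-≤ (suc n) (suc a) (suc b) {x} {y} (s≤s a≤b) (s≤s h) x≤ y≤ (inj₁ (x≤′ , L)) = begin
  x + y                          ≤⟨ +-monoʳ-≤ x (m≤n+m∸n y (n C b)) ⟩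
  x + (n C b + (y ∸ n C b))      ≡⟨ +-left-comm x (n C b) _ ⟩
  n C b + (x + (y ∸ n C b))      ≤⟨ +-monoʳ-≤ (n C b) (LexCross⇒sum-≤ n a (suc b) (m≤n⇒m≤1+n a≤b) h x≤′ (∸-bound-C n b y≤) L) ⟩
  n C b + n C suc b              ≡⟨ pascal n b ⟨
  suc n C suc b                  ∎
LexCross⇒sum-≤ (suc n) (suc a) (suc b) {x} {y} (s≤s a≤b) (s≤s h) x≤ y≤ (inj₂ (y≤′ , L)) with m≤n⇒m<n∨m≡n a≤b
-- The Pascal summands are matched crosswise: the star of a-sets is charged to the b-sets that avoid
-- the first point.
... | inj₁ a<b = begin
  x + y                          ≤⟨ +-monoˡ-≤ y (m≤n+m∸n x (n C a)) ⟩
  n C a + (x ∸ n C a) + y        ≡⟨ +-assoc (n C a) _ y ⟩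
  n C a + ((x ∸ n C a) + y)      ≤⟨ +-mono-≤ (C-monoʳ n a (suc b) (m≤n⇒m≤1+n a≤b) h)
                                      (LexCross⇒sum-≤ n (suc a) b a<b (subst (_≤ n) (+-suc a b) h) (∸-bound-C n a x≤) y≤′ L) ⟩
  n C suc b + n C b              ≡⟨ +-comm (n C suc b) (n C b) ⟩
  n C b + n C suc b              ≡⟨ pascal n b ⟨
  suc n C suc b                  ∎
-- For equal sizes the remaining pair has its larger size first, so the two roles are exchanged
-- before recursing.
... | inj₂ refl = begin
  x + y                          ≤⟨ +-monoˡ-≤ y (m≤n+m∸n x (n C a)) ⟩
  n C a + (x ∸ n C a) + y        ≡⟨ +-assoc (n C a) _ y ⟩
  n C a + ((x ∸ n C a) + y)      ≡⟨ cong (n C a +_) (+-comm _ y) ⟩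
  n C a + (y + (x ∸ n C a))      ≤⟨ +-monoʳ-≤ (n C a) (LexCross⇒sum-≤ n a (suc a) (n≤1+n a) h y≤′ (∸-bound-C n a x≤) (LexCross-sym n (suc a) a L)) ⟩
  n C a + n C suc a              ≡⟨ pascal n a ⟨
  suc n C suc a                  ∎

-- With m = n - a, this is what the extremal pair adds to the b-sets meeting an (a-1)-set E: the r
-- sets E ∪ {xᵢ}, and the b-sets that avoid E and contain every xᵢ.
tail : (m b r : ℕ) → ℕ
tail m b r = (suc m ∸ r) C (b ∸ r) + r

tail-suc : ∀ m b r → tail (suc m) (suc b) (suc r) ≡ suc (tail m b r)
tail-suc m b r = +-suc _ r

-- `m + 1` is the value of `tail` at r = b - 1 and its minimum. Descending with `tail-suc` to r = 0
-- leaves an instance of unimodality.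
m<tail : ∀ m b r → r < b → b ≤ m → m < tail m b r
m<tail m b zero 0<b b≤m = begin
  suc m              ≡⟨ nC1≡n (suc m) ⟨
  suc m C 1          ≤⟨ C-monoʳ (suc m) 1 b 0<b (s≤s b≤m) ⟩
  suc m C b          ≡⟨ +-identityʳ _ ⟨
  suc m C b + 0      ∎
m<tail (suc m) (suc b) (suc r) (s≤s r<b) (s≤s b≤m) =
  subst (suc m <_) (sym (tail-suc m b r)) (s≤s (m<tail m b r r<b b≤m))

-- This is the bound for the pair of all (a+1)-sets and no b-set, with `tail` at its least value.
-- Pascal's rule on a adds one term to each side, and these compare by unimodality.
full-segment-bound : ∀ a m b → suc a < b → b ≤ m →
  (suc a + m) C suc a + suc m C b ≤ (suc a + m) C b + suc m
full-segment-bound zero m b _ _ = ≤-reflexive (trans (cong (_+ suc m C b) (nC1≡n (suc m))) (+-comm (suc m) _))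
full-segment-bound (suc a) m (suc b) (s≤s a+2≤b) b<m = begin
  suc n C suc (suc a) + suc m C suc b        ≡⟨ cong (_+ suc m C suc b) (pascal n (suc a)) ⟩
  n C suc a + n C suc (suc a) + suc m C suc b  ≡⟨ +-swapʳ (n C suc a) _ _ ⟩
  n C suc a + suc m C suc b + n C suc (suc a)
    ≤⟨ +-mono-≤ (full-segment-bound a m (suc b) (m≤n⇒m≤1+n a+2≤b) b<m)
                (C-monoʳ n (suc (suc a)) b a+2≤b (s≤s (subst (_≤ a + m) (+-suc a b) (+-monoʳ-≤ a b<m)))) ⟩
  n C suc b + suc m + n C b                  ≡⟨ +-rotate (n C suc b) (suc m) (n C b) ⟩
  n C b + n C suc b + suc m                  ≡⟨ cong (_+ suc m) (pascal n b) ⟨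
  suc n C suc b + suc m                      ∎
  where
  n = suc a + m
  +-rotate : ∀ x y z → x + y + z ≡ z + x + y
  +-rotate = solve-∀

add-star : ∀ n b x y {q t} → x + (y ∸ n C b) + q ≤ n C suc b + t → x + y + q ≤ suc n C suc b + t
add-star n b x y {q} {t} h = begin
  x + y + q                        ≤⟨ +-monoˡ-≤ q (+-monoʳ-≤ x (m≤n+m∸n y (n C b))) ⟩
  x + (n C b + (y ∸ n C b)) + q    ≡⟨ rearrange x (n C b) (y ∸ n C b) q ⟩
  n C b + (x + (y ∸ n C b) + q)    ≤⟨ +-monoʳ-≤ (n C b) h ⟩
  n C b + (n C suc b + t)          ≡⟨ +-assoc (n C b) _ t ⟨
  n C b + n C suc b + t            ≡⟨ cong (_+ t) (pascal n b) ⟨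
  suc n C suc b + t                ∎
  where
  rearrange : ∀ p q s t → p + (q + s) + t ≡ q + (p + s + t)
  rearrange = solve-∀

-- While 𝓐 stays in the star, a drops and m, b, r, x are unchanged, so the increment `tail` is
-- carried along. The mutual recursion through `beyond-star` lowers b instead.
LexCross⇒sum-tail : ∀ a m b r {x y} → a < b → b ≤ m → r < b → r ≤ x →
  x ≤ (a + m) C a → y ≤ (a + m) C b → LexCross (a + m) a b x y →
  x + y + suc m C b ≤ (a + m) C b + tail m b r

-- 𝓑 now lies in the star and is counted as b-sets of the remaining points; 𝓐 is cut into the star
-- and its excess.
beyond-star : ∀ a m b r {x y} → a < b → b < m → r ≤ b → r ≤ x →
  x ≤ suc (a + m) C suc a → y ≤ (a + m) C b → LexCross (a + m) (suc a) b (x ∸ (a + m) C a) y →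
  x + y + suc m C suc b ≤ suc (a + m) C suc b + tail m (suc b) r

LexCross⇒sum-tail zero m b zero _ b≤m _ _ x≤ y≤ L =
  +-mono-≤ (LexCross⇒sum-≤ m 0 b z≤n b≤m x≤ y≤ L) (m≤m+n _ 0)
LexCross⇒sum-tail zero m b (suc r) _ b≤m _ () x≤ y≤ (inj₁ refl)
LexCross⇒sum-tail zero m (suc b) (suc r) {x} {y} _ b≤m _ r<x x≤ y≤ (inj₂ refl)
  -- The empty set is the only 0-set, so x ≤ 1, and the lower bound on x leaves r = 1 as the only
  -- positive value.
  with n≤0⇒n≡0 (s≤s⁻¹ (≤-trans r<x (≤-trans x≤ (≤-reflexive (nC0≡1 m)))))
... | refl = begin
  x + 0 + suc m C suc b          ≡⟨ cong (_+ suc m C suc b) (+-identityʳ x) ⟩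
  x + suc m C suc b              ≤⟨ +-monoˡ-≤ _ (≤-trans x≤ (≤-reflexive (nC0≡1 m))) ⟩
  1 + suc m C suc b              ≡⟨ cong (1 +_) (pascal m b) ⟩
  1 + (m C b + m C suc b)        ≡⟨ rearrange (m C b) (m C suc b) ⟩
  m C suc b + (m C b + 1)        ∎
  where
  rearrange : ∀ p q → 1 + (p + q) ≡ q + (p + 1)
  rearrange = solve-∀
LexCross⇒sum-tail (suc a) m (suc b) r {x} {y} (s≤s a<b) b≤m r<b r≤x x≤ y≤ L = split L
  where
  n = a + m

  inside-star : x ≤ n C a → LexCross n a (suc b) x (y ∸ n C b) →
                x + y + suc m C suc b ≤ suc n C suc b + tail m (suc b) r
  inside-star x≤′ L′ = add-star n b x y
    (LexCross⇒sum-tail a m (suc b) r (m≤n⇒m≤1+n a<b) b≤m r<b r≤x x≤′ (∸-bound-C n b y≤) L′)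

  split : LexCross (suc n) (suc a) (suc b) x y → x + y + suc m C suc b ≤ suc n C suc b + tail m (suc b) r
  split (inj₁ (x≤′ , L′)) = inside-star x≤′ L′
  split (inj₂ (y≤′ , L′)) with x ≤? n C a
  ... | no _    = beyond-star a m b r a<b b≤m (s≤s⁻¹ r<b) r≤x x≤ y≤′ L′
  ... | yes x≤′ = inside-star x≤′
    (subst (LexCross n a (suc b) x) (sym (m≤n⇒m∸n≡0 y≤′)) (LexCross-zeroʳ n a (suc b) x))

-- The excess and 𝓑 together are worth at most C(n, b), and the star is charged by
-- `full-segment-bound`. The result is `m + 1`, below every value of `tail`.
beyond-star (suc a) m b r {x} {y} a<b b<m r≤b r≤x x≤ y≤ L = begin
  x + y + suc m C suc b                            ≤⟨ +-monoˡ-≤ _ (+-monoˡ-≤ y (m≤n+m∸n x (n C suc a))) ⟩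
  n C suc a + (x ∸ n C suc a) + y + suc m C suc b  ≡⟨ rearrange (n C suc a) (x ∸ n C suc a) y (suc m C suc b) ⟩
  (x ∸ n C suc a) + y + (n C suc a + suc m C suc b)
    ≤⟨ +-mono-≤ (LexCross⇒sum-≤ n (suc (suc a)) b a<b (s≤s (subst (_≤ a + m) (+-suc a b) (+-monoʳ-≤ a b<m)))
                   (∸-bound-C n (suc a) x≤) y≤ L)
                (full-segment-bound a m (suc b) (s≤s (<⇒≤ a<b)) b<m) ⟩
  n C b + (n C suc b + suc m)                      ≤⟨ +-monoʳ-≤ (n C b) (+-monoʳ-≤ (n C suc b) (m<tail m (suc b) r (s≤s r≤b) b<m)) ⟩
  n C b + (n C suc b + tail m (suc b) r)           ≡⟨ +-assoc (n C b) _ _ ⟨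
  n C b + n C suc b + tail m (suc b) r             ≡⟨ cong (_+ tail m (suc b) r) (pascal n b) ⟨
  suc n C suc b + tail m (suc b) r                 ∎
  where
  n = suc a + m
  rearrange : ∀ p q s t → p + q + s + t ≡ q + s + (p + t)
  rearrange = solve-∀
-- Now 𝓐 consists of singletons, the star is a single set, and the terms C(m+1, b+1) cancel. The
-- crude estimate 1 + C(m, b) reaches `tail` for r ≤ 1 but can exceed it for r ≥ 2; there the excess
-- still has r - 1 singletons, and the main bound is applied to it with m, b and r lowered by one.
beyond-star zero m b r {x} {y} 0<b b<m r≤b r≤x x≤ y≤ L =
  ≤-trans (+-monoˡ-≤ _ (≤-trans x+y≤ (bound m r b<m r≤b r≤x x≤ y≤ L))) (≤-reflexive (+-comm _ (suc m C suc b)))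
  where
  x+y≤ : x + y ≤ suc ((x ∸ m C 0) + y)
  x+y≤ = +-monoˡ-≤ y (≤-trans (m≤n+m∸n x (m C 0)) (≤-reflexive (cong (_+ (x ∸ m C 0)) (nC0≡1 m))))

  bound : ∀ m r → b < m → r ≤ b → r ≤ x → x ≤ suc m C 1 → y ≤ m C b → LexCross m 1 b (x ∸ m C 0) y →
          suc ((x ∸ m C 0) + y) ≤ tail m (suc b) r
  bound m zero b<m _ _ x≤ y≤ L = begin
    1 + ((x ∸ m C 0) + y)  ≤⟨ +-mono-≤ (C-positive m (suc b) b<m) (LexCross⇒sum-≤ m 1 b 0<b b<m (∸-bound-C m 0 x≤) y≤ L) ⟩
    m C suc b + m C b      ≡⟨ +-comm (m C suc b) (m C b) ⟩
    m C b + m C suc b      ≡⟨ pascal m b ⟨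
    suc m C suc b          ≡⟨ +-identityʳ _ ⟨
    suc m C suc b + 0      ∎
  bound m (suc zero) b<m _ _ x≤ y≤ L = begin
    1 + ((x ∸ m C 0) + y)  ≤⟨ s≤s (LexCross⇒sum-≤ m 1 b 0<b b<m (∸-bound-C m 0 x≤) y≤ L) ⟩
    1 + m C b              ≡⟨ +-comm 1 (m C b) ⟩
    m C b + 1              ∎
  bound (suc m) (suc (suc r)) (s≤s b≤m) r<b r<x x≤ y≤ L = begin
    suc ((x ∸ suc m C 0) + y)        ≤⟨ s≤s (+-cancelʳ-≤ (suc m C b) _ _ ih) ⟩
    suc (tail m b (suc r))           ≡⟨ tail-suc m b (suc r) ⟨
    tail (suc m) (suc b) (suc (suc r))  ∎
    where
    ih : (x ∸ suc m C 0) + y + suc m C b ≤ tail m b (suc r) + suc m C b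
    ih = begin
      (x ∸ suc m C 0) + y + suc m C b
        ≤⟨ LexCross⇒sum-tail 1 m b (suc r) (≤-trans (s≤s (s≤s z≤n)) r<b) b≤m r<b
             (≤-trans (≤-reflexive (cong (suc (suc r) ∸_) (sym (nC0≡1 (suc m))))) (∸-monoˡ-≤ (suc m C 0) r<x))
             (∸-bound-C (suc m) 0 x≤) y≤ L ⟩
      suc m C b + tail m b (suc r)     ≡⟨ +-comm (suc m C b) _ ⟩
      tail m b (suc r) + suc m C b     ∎

balanced-sum-tail : ∀ b m r {x y} → b ≤ m → r < b → r ≤ x → r ≤ y →
  x ≤ (b + m) C b → y ≤ (b + m) C b → LexCross (b + m) b b x y →
  x + y + suc m C b ≤ (b + m) C b + tail m b r
balanced-sum-tail (suc b) m r {x} {y} b<m r<b r≤x r≤y x≤ y≤ = λ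
  { (inj₁ (x≤′ , L)) → star-case r≤x x≤′ y≤ L
  ; (inj₂ (y≤′ , L)) → subst (λ w → w + suc m C suc b ≤ suc n C suc b + tail m (suc b) r) (+-comm y x)
      (star-case r≤y y≤′ x≤ (LexCross-sym (b + m) (suc b) b L)) }
  where
  n = b + m
  star-case : ∀ {x y} → r ≤ x → x ≤ n C b → y ≤ suc n C suc b → LexCross n b (suc b) x (y ∸ n C b) →
              x + y + suc m C suc b ≤ suc n C suc b + tail m (suc b) r
  star-case {x} {y} r≤x x≤ y≤ L = add-star n b x y
    (LexCross⇒sum-tail b m (suc b) r ≤-refl b<m r<b r≤x x≤ (∸-bound-C n b y≤) L)

-- C(n, b) - C(n-k, b) counts the b-sets that meet the first k = a - b points. Having q ≥ 1 more
-- members pushes 𝓑 out of k stars in turn, so 𝓐 stays inside each of them, and q members of 𝓑 are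
-- left for the case of equal sizes. The threshold q is kept apart from the parameter r of `tail`,
-- which may be 0.
unbalanced-sum-tail : ∀ k b m q r {x y} → b ≤ m → 1 ≤ q → r ≤ q → r < b → q ≤ x →
  (k + (b + m)) C b + q ≤ y + (b + m) C b → x ≤ (k + (b + m)) C (k + b) → y ≤ (k + (b + m)) C b →
  LexCross (k + (b + m)) (k + b) b x y →
  x + y + suc m C b ≤ (k + (b + m)) C b + tail m b r
unbalanced-sum-tail zero b m q r {x} {y} b≤m _ r≤q r<b q≤x big x≤ y≤ L =
  balanced-sum-tail b m r b≤m r<b (≤-trans r≤q q≤x)
    (≤-trans r≤q (+-cancelˡ-≤ ((b + m) C b) _ _ (≤-trans big (≤-reflexive (+-comm y _))))) x≤ y≤ L
unbalanced-sum-tail (suc k) (suc b) m q r {x} {y} b≤m 1≤q r≤q r<b q≤x big x≤ y≤ = λ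
  { (inj₁ (x≤′ , L)) → add-star n b x y
      (unbalanced-sum-tail k (suc b) m q r b≤m 1≤q r≤q r<b q≤x (+-cancelˡ-≤ (n C b) _ _ (begin
          n C b + (n C suc b + q)            ≤⟨ big′ ⟩
          y + Z                              ≤⟨ +-monoˡ-≤ Z (m≤n+m∸n y (n C b)) ⟩
          n C b + (y ∸ n C b) + Z            ≡⟨ +-assoc (n C b) _ Z ⟩
          n C b + ((y ∸ n C b) + Z)          ∎))
        x≤′ (∸-bound-C n b y≤) L)
  ; (inj₂ (y≤′ , _)) → contradiction 1≤q (<⇒≱ (s≤s (+-cancelˡ-≤ (n C suc b) _ _ (begin
      n C suc b + q  ≤⟨ +-cancelˡ-≤ (n C b) _ _ (≤-trans big′ (+-monoˡ-≤ Z y≤′)) ⟩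
      Z              ≤⟨ C-monoˡ k (suc b + m) (suc b) ⟩
      n C suc b      ≡⟨ +-identityʳ _ ⟨
      n C suc b + 0  ∎)))) }
  where
  n = k + (suc b + m)
  Z = (suc b + m) C suc b

  big′ : n C b + (n C suc b + q) ≤ y + Z
  big′ = begin
    n C b + (n C suc b + q)  ≡⟨ +-assoc (n C b) _ q ⟨
    n C b + n C suc b + q    ≡⟨ cong (_+ q) (pascal n b) ⟨
    suc n C suc b + q        ≤⟨ big ⟩
    y + Z                    ∎

-- Families as characteristic functions

Family : ℕ → Set
Family n = Subset n → Bool

bit : Bool → ℕ
bit false = 0
bit true  = 1

total : ∀ {n} → (Subset n → ℕ) → ℕ
total {zero}  w = w []
total {suc n} w = total (w ∘ (true ∷_)) + total (w ∘ (false ∷_))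

size : ∀ {n} → Family n → ℕ
size f = total (bit ∘ f)

total-mono : ∀ {n} {v w : Subset n → ℕ} → (∀ S → v S ≤ w S) → total v ≤ total w
total-mono {zero}  h = h []
total-mono {suc n} h = +-mono-≤ (total-mono (h ∘ (true ∷_))) (total-mono (h ∘ (false ∷_)))

total-cong : ∀ {n} {v w : Subset n → ℕ} → (∀ S → v S ≡ w S) → total v ≡ total w
total-cong h = ≤-antisym (total-mono (≤-reflexive ∘ h)) (total-mono (≤-reflexive ∘ sym ∘ h))

total-+ : ∀ {n} (v w : Subset n → ℕ) → total (λ S → v S + w S) ≡ total v + total w
total-+ {zero}  v w = refl
total-+ {suc n} v w = trans (cong₂ _+_ (total-+ (v ∘ (true ∷_)) _) (total-+ (v ∘ (false ∷_)) _))
  (+-interchange (total (v ∘ (true ∷_))) _ _ _)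

total-zero : ∀ n → total {n} (λ _ → 0) ≡ 0
total-zero zero = refl
total-zero (suc n) = cong₂ _+_ (total-zero n) (total-zero n)

total-∁ : ∀ {n} (w : Subset n → ℕ) → total (w ∘ ∁) ≡ total w
total-∁ {zero}  w = refl
total-∁ {suc n} w = trans (cong₂ _+_ (total-∁ (w ∘ (false ∷_))) (total-∁ (w ∘ (true ∷_))))
  (+-comm (total (w ∘ (false ∷_))) _)

bit-mono : ∀ {p q} → (p ≡ true → q ≡ true) → bit p ≤ bit q
bit-mono {false} _ = z≤n
bit-mono {true} h rewrite h refl = ≤-refl

size-mono : ∀ {n} {f g : Family n} → (∀ S → f S ≡ true → g S ≡ true) → size f ≤ size g
size-mono h = total-mono (bit-mono ∘ h)

size-antisym : ∀ {n} {f g : Family n} → (∀ S → f S ≡ true → g S ≡ true) → size g ≤ size f →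
  ∀ S → g S ≡ true → f S ≡ true
size-antisym {zero} {f} {g} _ le [] gS with f []
... | true  = refl
... | false = contradiction (subst (λ p → bit p ≤ 0) gS le) λ ()
size-antisym {suc n} {f} {g} h le (true ∷ S) gS =
  size-antisym (h ∘ (true ∷_)) (+-cancelʳ-≤ (size (f ∘ (false ∷_))) _ _ (begin
    size (g ∘ (true ∷_)) + size (f ∘ (false ∷_))  ≤⟨ +-monoʳ-≤ _ (size-mono (h ∘ (false ∷_))) ⟩
    size g                                        ≤⟨ le ⟩
    size f                                        ∎)) S gS
size-antisym {suc n} {f} {g} h le (false ∷ S) gS =
  size-antisym (h ∘ (false ∷_)) (+-cancelˡ-≤ (size (f ∘ (true ∷_))) _ _ (begin
    size (f ∘ (true ∷_)) + size (g ∘ (false ∷_))  ≤⟨ +-monoˡ-≤ _ (size-mono (h ∘ (true ∷_))) ⟩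
    size g                                        ≤⟨ le ⟩
    size f                                        ∎)) S gS

empty-or-member : ∀ {n} (f : Family n) → size f ≡ 0 ⊎ ∃ λ S → f S ≡ true
empty-or-member {zero} f with f [] in eq
... | true  = inj₂ ([] , eq)
... | false = inj₁ refl
empty-or-member {suc n} f with empty-or-member (f ∘ (true ∷_)) | empty-or-member (f ∘ (false ∷_))
... | inj₂ (S , p) | _            = inj₂ (true ∷ S , p)
... | inj₁ _       | inj₂ (S , p) = inj₂ (false ∷ S , p)
... | inj₁ p       | inj₁ q       = inj₁ (cong₂ _+_ p q)

layer : ∀ {n} → ℕ → Family n
layer k S = ∣ S ∣ ≡ᵇ k

size-layer : ∀ n k → size (layer {n} k) ≡ n C k
size-layer zero zero = refl
size-layer zero (suc k) = refl
size-layer (suc n) zero = trans (cong₂ _+_ (total-zero n) (trans (size-layer n zero) (nC0≡1 n))) (sym (nC0≡1 (suc n)))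
size-layer (suc n) (suc k) = trans (cong₂ _+_ (size-layer n k) (size-layer n (suc k))) (sym (pascal n k))

≡ᵇ-refl : ∀ k → (k ≡ᵇ k) ≡ true
≡ᵇ-refl zero = refl
≡ᵇ-refl (suc k) = ≡ᵇ-refl k

≡ᵇ-sound : ∀ k l → (k ≡ᵇ l) ≡ true → k ≡ l
≡ᵇ-sound zero zero _ = refl
≡ᵇ-sound (suc k) (suc l) h = cong suc (≡ᵇ-sound k l h)

Uniform : ∀ {n} → ℕ → Family n → Set
Uniform k f = ∀ S → f S ≡ true → ∣ S ∣ ≡ k

Uniform⇒layer : ∀ {n k} {f : Family n} → Uniform k f → ∀ S → f S ≡ true → layer k S ≡ true
Uniform⇒layer {k = k} u S fS = subst (λ l → (l ≡ᵇ k) ≡ true) (sym (u S fS)) (≡ᵇ-refl k)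

Uniform⇒size-≤ : ∀ {n} k {f : Family n} → Uniform k f → size f ≤ n C k
Uniform⇒size-≤ {n} k u = ≤-trans (size-mono (Uniform⇒layer u)) (≤-reflexive (size-layer n k))

-- Intersections

Meets : ∀ {n} → Subset n → Subset n → Set
Meets S T = ∃ λ i → lookup S i ≡ true × lookup T i ≡ true

Cross : ∀ {n} → Family n → Family n → Set
Cross f g = ∀ S T → f S ≡ true → g T ≡ true → Meets S T

Meets-sym : ∀ {n} (S T : Subset n) → Meets S T → Meets T S
Meets-sym S T (i , p , q) = i , q , p

Meets-∷ : ∀ {n s t} {S T : Subset n} → Meets S T → Meets (s ∷ S) (t ∷ T)
Meets-∷ (i , p , q) = suc i , p , q

Meets-∷⁻ : ∀ {n s t} {S T : Subset n} → ¬ (s ≡ true × t ≡ true) → Meets (s ∷ S) (t ∷ T) → Meets S T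
Meets-∷⁻ h (zero , p , q) = contradiction (p , q) h
Meets-∷⁻ h (suc i , p , q) = i , p , q

-- The condition excludes j as a meeting point, and every other point is untouched by the update.
Meets-update : ∀ {n} (S T : Subset n) j {v} → v ≡ false ⊎ lookup T j ≡ false →
  Meets (S [ j ]≔ v) T → Meets S T
Meets-update S T j {v} h (i , p , q) with i ≟ᶠ j
... | no i≢j   = i , trans (sym (lookup∘update′ i≢j S v)) p , q
... | yes refl with trans (sym (lookup∘update i S v)) p | h
...   | refl | inj₂ r = contradiction (trans (sym q) r) λ ()

Meets-updateʳ : ∀ {n} (S T : Subset n) j {v} → v ≡ false ⊎ lookup S j ≡ false →
  Meets S (T [ j ]≔ v) → Meets S T
Meets-updateʳ S T j h m = Meets-sym T S (Meets-update T S j h (Meets-sym S (T [ j ]≔ _) m))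

¬Meets-∁ : ∀ {n} (S : Subset n) → ¬ Meets S (∁ S)
¬Meets-∁ S (i , p , q) with trans (sym q) (trans (lookup-map i not S) (cong not p))
... | ()

∣p∣+∣∁p∣≡n : ∀ {n} (S : Subset n) → ∣ S ∣ + ∣ ∁ S ∣ ≡ n
∣p∣+∣∁p∣≡n [] = refl
∣p∣+∣∁p∣≡n (true ∷ S) = cong suc (∣p∣+∣∁p∣≡n S)
∣p∣+∣∁p∣≡n (false ∷ S) = trans (+-suc ∣ S ∣ _) (cong suc (∣p∣+∣∁p∣≡n S))

large⇒Meets : ∀ {n} (S T : Subset n) → n < ∣ S ∣ + ∣ T ∣ → Meets S T
large⇒Meets [] [] ()
large⇒Meets (true ∷ S) (true ∷ T) _ = zero , refl , refl
large⇒Meets (true ∷ S) (false ∷ T) h = Meets-∷ (large⇒Meets S T (s≤s⁻¹ h))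
large⇒Meets (false ∷ S) (true ∷ T) h = Meets-∷ (large⇒Meets S T (s≤s⁻¹ (≤-trans h (≤-reflexive (+-suc ∣ S ∣ ∣ T ∣)))))
large⇒Meets (false ∷ S) (false ∷ T) h = Meets-∷ (large⇒Meets S T (<-trans (n<1+n _) h))

Meets⊎complement : ∀ {n} (S T : Subset n) → ∣ S ∣ + ∣ T ∣ ≡ n → Meets S T ⊎ S ≡ ∁ T
Meets⊎complement [] [] _ = inj₂ refl
Meets⊎complement (true ∷ S) (true ∷ T) _ = inj₁ (zero , refl , refl)
Meets⊎complement (true ∷ S) (false ∷ T) h = ⊎-map Meets-∷ (cong (true ∷_)) (Meets⊎complement S T (suc-injective h))
Meets⊎complement (false ∷ S) (true ∷ T) h =
  ⊎-map Meets-∷ (cong (false ∷_)) (Meets⊎complement S T (suc-injective (trans (sym (+-suc ∣ S ∣ ∣ T ∣)) h)))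
Meets⊎complement (false ∷ S) (false ∷ T) h = inj₁ (Meets-∷ (large⇒Meets S T (≤-reflexive (sym h))))

Meets⊎complement-insert : ∀ {n} (S T : Subset n) → suc (∣ S ∣ + ∣ T ∣) ≡ n →
  Meets S T ⊎ ∃ λ j → lookup S j ≡ false × S [ j ]≔ true ≡ ∁ T
Meets⊎complement-insert (true ∷ S) (true ∷ T) _ = inj₁ (zero , refl , refl)
Meets⊎complement-insert (true ∷ S) (false ∷ T) h =
  ⊎-map Meets-∷ (λ (j , p , q) → suc j , p , cong (true ∷_) q) (Meets⊎complement-insert S T (suc-injective h))
Meets⊎complement-insert (false ∷ S) (true ∷ T) h =
  ⊎-map Meets-∷ (λ (j , p , q) → suc j , p , cong (false ∷_) q)
    (Meets⊎complement-insert S T (suc-injective (trans (cong suc (sym (+-suc ∣ S ∣ ∣ T ∣))) h)))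
Meets⊎complement-insert (false ∷ S) (false ∷ T) h =
  ⊎-map Meets-∷ (λ q → zero , refl , cong (true ∷_) q) (Meets⊎complement S T (suc-injective h))

∣delete∣ : ∀ {n} (S : Subset n) j → lookup S j ≡ true → ∣ S ∣ ≡ suc ∣ S [ j ]≔ false ∣
∣delete∣ (true ∷ S) zero _ = refl
∣delete∣ (true ∷ S) (suc j) h = cong suc (∣delete∣ S j h)
∣delete∣ (false ∷ S) (suc j) h = ∣delete∣ S j h

-- Shifting away from a point

-- A family on [n+1] is given by a pair f₁, f₀: its members containing, resp. avoiding, the point to
-- be vacated.  The shift to j replaces that point by j in every member where the result is new.
kept moved : ∀ {n} → Fin n → Family n → Family n → Family n
kept  j f₁ f₀ S = if lookup S j then f₁ S else (f₁ S ∧ f₀ (S [ j ]≔ true))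
moved j f₁ f₀ S = if lookup S j then (f₀ S ∨ f₁ (S [ j ]≔ false)) else f₀ S

bit-∧∨ : ∀ p q → bit (p ∧ q) + bit (q ∨ p) ≡ bit p + bit q
bit-∧∨ true true = refl
bit-∧∨ true false = refl
bit-∧∨ false true = refl
bit-∧∨ false false = refl

shift-size : ∀ {n} (j : Fin n) f₁ f₀ → size (kept j f₁ f₀) + size (moved j f₁ f₀) ≡ size f₁ + size f₀
shift-size zero f₁ f₀ = begin-equality
  (A + size K) + (size M + D)    ≡⟨ rearrange A (size K) (size M) D ⟩
  A + (size K + size M) + D      ≡⟨ cong (λ w → A + w + D) K+M ⟩
  A + (B + E) + D                ≡⟨ rearrange A B E D ⟨
  (A + B) + (E + D)              ∎
  where
  A = size (f₁ ∘ (true ∷_))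
  B = size (f₁ ∘ (false ∷_))
  E = size (f₀ ∘ (true ∷_))
  D = size (f₀ ∘ (false ∷_))
  K = kept zero f₁ f₀ ∘ (false ∷_)
  M = moved zero f₁ f₀ ∘ (true ∷_)
  K+M : size K + size M ≡ B + E
  K+M = trans (sym (total-+ (bit ∘ K) (bit ∘ M)))
    (trans (total-cong (λ S → bit-∧∨ (f₁ (false ∷ S)) (f₀ (true ∷ S)))) (total-+ (bit ∘ f₁ ∘ (false ∷_)) _))
  rearrange : ∀ p q s t → (p + q) + (s + t) ≡ p + (q + s) + t
  rearrange = solve-∀
shift-size (suc j) f₁ f₀ = trans (+-interchange (size (kept j (f₁ ∘ (true ∷_)) (f₀ ∘ (true ∷_)))) _ _ _)
  (trans (cong₂ _+_ (shift-size j (f₁ ∘ (true ∷_)) (f₀ ∘ (true ∷_))) (shift-size j (f₁ ∘ (false ∷_)) (f₀ ∘ (false ∷_))))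
    (+-interchange (size (f₁ ∘ (true ∷_))) _ _ _))

∧-true : ∀ p q → p ∧ q ≡ true → p ≡ true × q ≡ true
∧-true true true _ = refl , refl

∨-true : ∀ p q → p ∨ q ≡ true → p ≡ true ⊎ q ≡ true
∨-true true _ _ = inj₁ refl
∨-true false _ h = inj₂ h

kept⁻ : ∀ {n} (j : Fin n) f₁ f₀ S → kept j f₁ f₀ S ≡ true →
  f₁ S ≡ true × (lookup S j ≡ true ⊎ (lookup S j ≡ false × f₀ (S [ j ]≔ true) ≡ true))
kept⁻ j f₁ f₀ S h with lookup S j
... | true  = h , inj₁ refl
... | false with ∧-true (f₁ S) _ h
...   | p , q = p , inj₂ (refl , q)

moved⁻ : ∀ {n} (j : Fin n) f₁ f₀ S → moved j f₁ f₀ S ≡ true →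
  f₀ S ≡ true ⊎ (lookup S j ≡ true × f₁ (S [ j ]≔ false) ≡ true)
moved⁻ j f₁ f₀ S h with lookup S j
... | false = inj₁ h
... | true  = ⊎-map₂ (refl ,_) (∨-true (f₀ S) _ h)

Uniform-moved : ∀ {n k} (j : Fin n) {f₁ f₀} → Uniform k f₁ → Uniform (suc k) f₀ → Uniform (suc k) (moved j f₁ f₀)
Uniform-moved j {f₁} {f₀} u₁ u₀ S h with moved⁻ j f₁ f₀ S h
... | inj₁ p       = u₀ S p
... | inj₂ (p , q) = trans (∣delete∣ S j p) (cong suc (u₁ _ q))

Uniform-kept : ∀ {n k} (j : Fin n) f₁ f₀ → Uniform k f₁ → Uniform k (kept j f₁ f₀)
Uniform-kept j f₁ f₀ u₁ S h = u₁ S (proj₁ (kept⁻ j f₁ f₀ S h))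

Cross-sym : ∀ {n} {f g : Family n} → Cross f g → Cross g f
Cross-sym c T S p q = Meets-sym S T (c S T q p)

Cross-moved-moved : ∀ {n} (j : Fin n) {f₁ f₀ g₁ g₀} → Cross f₀ g₀ → Cross f₁ g₀ → Cross f₀ g₁ →
  Cross (moved j f₁ f₀) (moved j g₁ g₀)
Cross-moved-moved j {f₁} {f₀} {g₁} {g₀} c₀₀ c₁₀ c₀₁ S T h k with moved⁻ j f₁ f₀ S h | moved⁻ j g₁ g₀ T k
... | inj₁ p       | inj₁ q       = c₀₀ S T p q
... | inj₂ (_ , p) | inj₁ q       = Meets-update S T j (inj₁ refl) (c₁₀ _ T p q)
... | inj₁ p       | inj₂ (_ , q) = Meets-updateʳ S T j (inj₁ refl) (c₀₁ S _ p q)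
... | inj₂ (s , _) | inj₂ (t , _) = j , s , t

Cross-kept-moved : ∀ {n} (j : Fin n) {f₁ f₀ g₁ g₀} → Cross f₁ g₀ → Cross f₀ g₁ →
  Cross (kept j f₁ f₀) (moved j g₁ g₀)
Cross-kept-moved j {f₁} {f₀} {g₁} {g₀} c₁₀ c₀₁ S T h k with kept⁻ j f₁ f₀ S h | moved⁻ j g₁ g₀ T k
... | p , _             | inj₁ q       = c₁₀ S T p q
... | _ , inj₁ s        | inj₂ (t , _) = j , s , t
-- S stayed because S ∪ {j} was already present in `f₀`. It meets T without j, necessarily at a
-- point other than j, and that point lies in S and T.
... | _ , inj₂ (_ , p′) | inj₂ (_ , q) = Meets-updateʳ S T j (inj₁ refl)
  (Meets-update S (T [ j ]≔ false) j (inj₂ (lookup∘update j T false)) (c₀₁ _ _ p′ q))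

Stable : ∀ {n} → Family n → Family n → Set
Stable f₁ f₀ = ∀ j S → lookup S j ≡ false → f₁ S ≡ true → f₀ (S [ j ]≔ true) ≡ true

-- `kept` is a subfamily of `f₁`, so if no shift lowers its size then every shift leaves `f₁` as it
-- is, which is stability.
stable⊎shrinks : ∀ {n} (f₁ f₀ : Family n) → Stable f₁ f₀ ⊎ ∃ λ j → size (kept j f₁ f₀) < size f₁
stable⊎shrinks f₁ f₀ with all? (λ j → size f₁ ≤? size (kept j f₁ f₀))
... | no ¬all with ¬∀⟶∃¬ _ _ (λ j → size f₁ ≤? size (kept j f₁ f₀)) ¬all
...   | j , ≰ = inj₂ (j , ≰⇒> ≰)
stable⊎shrinks f₁ f₀ | yes all = inj₁ stable
  where
  stable : Stable f₁ f₀
  stable j S s p with kept⁻ j f₁ f₀ S (size-antisym (λ S → proj₁ ∘ kept⁻ j f₁ f₀ S) (all j) S p)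
  ... | _ , inj₁ s′      = contradiction (trans (sym s) s′) λ ()
  ... | _ , inj₂ (_ , q) = q

size-kept-≤ : ∀ {n} (j : Fin n) (f₁ f₀ : Family n) → size (kept j f₁ f₀) ≤ size f₁
size-kept-≤ j f₁ f₀ = size-mono λ S → proj₁ ∘ kept⁻ j f₁ f₀ S

-- The Kruskal–Katona theorem in Hilton's cross-intersecting form

empty⇒¬Meets : ∀ {n} (S T : Subset n) → ∣ S ∣ ≡ 0 → ¬ Meets S T
empty⇒¬Meets (false ∷ S) (t ∷ T) h (suc i , p , q) = empty⇒¬Meets S T h (i , p , q)

Cross-empty : ∀ {n} {f g : Family n} → Uniform 0 f → Cross f g → size f ≡ 0 ⊎ size g ≡ 0
Cross-empty {f = f} {g} u c with empty-or-member f | empty-or-member g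
... | inj₁ p       | _            = inj₁ p
... | inj₂ _       | inj₁ q       = inj₂ q
... | inj₂ (S , p) | inj₂ (T , q) = contradiction (c S T p q) (empty⇒¬Meets S T (u S p))

-- Disjoint sets cannot belong to f and g respectively, so f and the complements of g are disjoint
-- parts of the layer of a-sets.
Cross-complementary : ∀ {n} a b {f g : Family n} → a + b ≡ n → Uniform a f → Uniform b g → Cross f g →
  size f + size g ≤ n C a
Cross-complementary {n} a b {f} {g} e uf ug c = begin
  size f + size g                             ≡⟨ cong (size f +_) (total-∁ (bit ∘ g)) ⟨
  size f + total (bit ∘ g ∘ ∁)                ≡⟨ total-+ (bit ∘ f) (bit ∘ g ∘ ∁) ⟨
  total (λ S → bit (f S) + bit (g (∁ S)))     ≤⟨ total-mono pointwise ⟩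
  size (layer {n} a)                          ≡⟨ size-layer n a ⟩
  n C a                                       ∎
  where
  pointwise : ∀ S → bit (f S) + bit (g (∁ S)) ≤ bit (layer a S)
  pointwise S with f S in p | g (∁ S) in q
  ... | true  | true  = contradiction (c S (∁ S) p q) (¬Meets-∁ S)
  ... | true  | false rewrite Uniform⇒layer uf S p = ≤-refl
  ... | false | false = z≤n
  ... | false | true  = bit-mono {true} λ _ → subst (λ k → (k ≡ᵇ a) ≡ true)
    (+-cancelʳ-≡ b a ∣ S ∣ (trans e (sym (trans (cong (∣ S ∣ +_) (sym (ug (∁ S) q))) (∣p∣+∣∁p∣≡n S))))) (≡ᵇ-refl a)

complement-missing : ∀ {n} → ℕ → Family n → Family n
complement-missing c f T = layer c T ∧ not (f (∁ T))

-- The argument `kk` is the induction hypothesis on n points. It is applied to `f₁` and the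
-- complements of the (a+1)-sets missing from `f₀`, which cross because of stability.
stable-lexDelete : ∀ n a {f₁ f₀ : Family n} →
  (∀ c (g : Family n) → a + c ≤ n → Uniform c g → Cross f₁ g → LexCross n a c (size f₁) (size g)) →
  suc a ≤ n → Uniform a f₁ → Uniform (suc a) f₀ → Stable f₁ f₀ →
  lexDelete n (suc a) (size f₁ + size f₀) ≤ size f₀
stable-lexDelete n a {f₁} {f₀} kk a<n u₁ u₀ st with m≤n⇒∃[o]m+o≡n a<n
... | c , e = lexDelete-≤-avoiding n a c e (Uniform⇒size-≤ a u₁) (Uniform⇒size-≤ (suc a) u₀) covers
        (kk c g (≤-trans (n≤1+n _) (≤-reflexive e)) uniform cross)
  where
  g = complement-missing c f₀

  uniform : Uniform c g
  uniform T h = ≡ᵇ-sound ∣ T ∣ c (proj₁ (∧-true (layer c T) _ h))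

  cross : Cross f₁ g
  cross S T p h with Meets⊎complement-insert S T (trans (cong₂ (λ k l → suc (k + l)) (u₁ S p) (uniform T h)) e)
  ... | inj₁ m           = m
  -- If S and T were disjoint, the complement of T would be S with one point j added. Stability puts
  -- that set into `f₀`, whereas T was chosen with its complement missing.
  ... | inj₂ (j , s , q) with trans (cong not (sym (trans (cong f₀ (sym q)) (st j S s p)))) (proj₂ (∧-true (layer c T) _ h))
  ...   | ()

  pointwise : ∀ p q → bit p ≤ bit (p ∧ not q) + bit q
  pointwise false _ = z≤n
  pointwise true false = ≤-refl
  pointwise true true = ≤-refl

  covers : n C suc a ≤ size g + size f₀
  covers = begin
    n C suc a                                    ≡⟨ C-sym (suc a) c e ⟩
    n C c                                        ≡⟨ size-layer n c ⟨
    size (layer {n} c)                           ≤⟨ total-mono (λ T → pointwise (layer c T) (f₀ (∁ T))) ⟩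
    total (λ T → bit (g T) + bit (f₀ (∁ T)))     ≡⟨ total-+ (bit ∘ g) (bit ∘ f₀ ∘ ∁) ⟩
    size g + total (bit ∘ f₀ ∘ ∁)                ≡⟨ cong (size g +_) (total-∁ (bit ∘ f₀)) ⟩
    size g + size f₀                             ∎

-- Induction on n. Once both families are stable, the members avoiding the vacated point cross on
-- [n-1] and are at least as many as the shortened segments, so `LexCross-lift` returns to [n].
Cross⇒LexCross : ∀ n a b (f g : Family n) → a + b ≤ n → Uniform a f → Uniform b g → Cross f g →
  LexCross n a b (size f) (size g)
Cross⇒LexCross n zero b f g _ uf ug c = Cross-empty uf c
Cross⇒LexCross n (suc a) zero f g _ uf ug c = swap-zero (Cross-empty ug (Cross-sym c))
Cross⇒LexCross (suc n) (suc a) (suc b) f g h uf ug c with m≤n⇒m<n∨m≡n h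
... | inj₂ e = LexCross-complementary (suc n) (suc a) (suc b) e (Cross-complementary (suc a) (suc b) e uf ug c)
... | inj₁ (s≤s h′) = shifting (f ∘ (true ∷_)) (f ∘ (false ∷_)) (g ∘ (true ∷_)) (g ∘ (false ∷_)) (<-wellFounded _)
    (λ S → suc-injective ∘ uf (true ∷ S)) (λ S → uf (false ∷ S))
    (λ S → suc-injective ∘ ug (true ∷ S)) (λ S → ug (false ∷ S))
    (λ S T p q → Meets-∷⁻ (λ ()) (c (false ∷ S) (false ∷ T) p q))
    (λ S T p q → Meets-∷⁻ (λ ()) (c (true ∷ S) (false ∷ T) p q))
    (λ S T p q → Meets-∷⁻ (λ ()) (c (false ∷ S) (true ∷ T) p q))
  where
  -- Members that contain the vacated point on both sides meet there, so three cross conditions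
  -- describe the pair. The measure counts the members still containing that point.
  shifting : ∀ (f₁ f₀ g₁ g₀ : Family n) → Acc _<_ (size f₁ + size g₁) →
    Uniform a f₁ → Uniform (suc a) f₀ → Uniform b g₁ → Uniform (suc b) g₀ →
    Cross f₀ g₀ → Cross f₁ g₀ → Cross f₀ g₁ →
    LexCross (suc n) (suc a) (suc b) (size f₁ + size f₀) (size g₁ + size g₀)
  shifting f₁ f₀ g₁ g₀ (acc rs) uf₁ uf₀ ug₁ ug₀ c₀₀ c₁₀ c₀₁ = step (stable⊎shrinks f₁ f₀) (stable⊎shrinks g₁ g₀)
    where
    -- Both families are shifted to the same j, since shifting one alone could destroy the crossing;
    -- one strict decrease is enough.
    shift-to : ∀ j → size (kept j f₁ f₀) + size (kept j g₁ g₀) < size f₁ + size g₁ →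
      LexCross (suc n) (suc a) (suc b) (size f₁ + size f₀) (size g₁ + size g₀)
    shift-to j lt = subst₂ (LexCross (suc n) (suc a) (suc b)) (shift-size j f₁ f₀) (shift-size j g₁ g₀)
      (shifting (kept j f₁ f₀) (moved j f₁ f₀) (kept j g₁ g₀) (moved j g₁ g₀) (rs lt)
        (Uniform-kept j f₁ f₀ uf₁) (Uniform-moved j uf₁ uf₀) (Uniform-kept j g₁ g₀ ug₁) (Uniform-moved j ug₁ ug₀)
        (Cross-moved-moved j c₀₀ c₁₀ c₀₁) (Cross-kept-moved j c₁₀ c₀₁)
        (Cross-sym (Cross-kept-moved j (Cross-sym c₀₁) (Cross-sym c₁₀))))

    step : Stable f₁ f₀ ⊎ (∃ λ j → size (kept j f₁ f₀) < size f₁) →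
           Stable g₁ g₀ ⊎ (∃ λ j → size (kept j g₁ g₀) < size g₁) →
           LexCross (suc n) (suc a) (suc b) (size f₁ + size f₀) (size g₁ + size g₀)
    step (inj₁ sf) (inj₁ sg) = LexCross-lift n (suc a) (suc b) _ _ h′
      (LexCross-antitone n (suc a) (suc b)
        (stable-lexDelete n a (λ c k l → Cross⇒LexCross n a c f₁ k l uf₁) (m+n≤o⇒m≤o (suc a) h′) uf₁ uf₀ sf)
        (stable-lexDelete n b (λ c k l → Cross⇒LexCross n b c g₁ k l ug₁) (m+n≤o⇒n≤o (suc a) h′) ug₁ ug₀ sg)
        (Cross⇒LexCross n (suc a) (suc b) f₀ g₀ h′ uf₀ ug₀ c₀₀))
    step (inj₂ (j , lt)) _ = shift-to j (+-mono-<-≤ lt (size-kept-≤ j g₁ g₀))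
    step (inj₁ _) (inj₂ (j , lt)) = shift-to j (+-mono-≤-< (size-kept-≤ j f₁ f₀) lt)

-- Lists as families

_≟ˢ_ : ∀ {n} (S T : Subset n) → Dec (S ≡ T)
_≟ˢ_ = ≡-dec _≟ᵇ_

memberOf : ∀ {n} → List (Subset n) → Family n
memberOf [] S = false
memberOf (A ∷ 𝓐) S = does (S ≟ˢ A) ∨ memberOf 𝓐 S

memberOf-sound : ∀ {n} (𝓐 : List (Subset n)) S → memberOf 𝓐 S ≡ true → S ∈ 𝓐
memberOf-sound (A ∷ 𝓐) S h with S ≟ˢ A
... | yes S≡A = here S≡A
... | no _    = there (memberOf-sound 𝓐 S h)

member⇒size-positive : ∀ {n} (f : Family n) S → f S ≡ true → 1 ≤ size f
member⇒size-positive f [] h = subst (λ p → 1 ≤ bit p) (sym h) ≤-refl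
member⇒size-positive f (true ∷ S) h = ≤-trans (member⇒size-positive (f ∘ (true ∷_)) S h) (m≤m+n _ _)
member⇒size-positive f (false ∷ S) h = ≤-trans (member⇒size-positive (f ∘ (false ∷_)) S h) (m≤n+m _ _)

length≤size : ∀ {n} (𝓐 : List (Subset n)) → Unique 𝓐 → length 𝓐 ≤ size (memberOf 𝓐)
length≤size [] _ = z≤n
length≤size {n} (A ∷ 𝓐) (A∉𝓐 ∷ unique) = begin
  1 + length 𝓐                                     ≤⟨ +-mono-≤ (member⇒size-positive single A (dec-true (A ≟ˢ A) refl)) (length≤size 𝓐 unique) ⟩
  size single + size (memberOf 𝓐)                  ≡⟨ total-+ (bit ∘ single) (bit ∘ memberOf 𝓐) ⟨
  total (λ S → bit (single S) + bit (memberOf 𝓐 S))  ≤⟨ total-mono pointwise ⟩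
  size (memberOf (A ∷ 𝓐))                          ∎
  where
  single : Family n
  single S = does (S ≟ˢ A)

  pointwise : ∀ S → bit (single S) + bit (memberOf 𝓐 S) ≤ bit (memberOf (A ∷ 𝓐) S)
  pointwise S with S ≟ˢ A | memberOf 𝓐 S in eq
  ... | no _     | _     = ≤-refl
  ... | yes _    | false = ≤-refl
  ... | yes refl | true  = contradiction refl (All.lookup A∉𝓐 (memberOf-sound 𝓐 A eq))

lists⇒LexCross : ∀ n a b (𝓐 𝓑 : List (Subset n)) → a + b ≤ n →
  IsUniformFamily n a 𝓐 → IsUniformFamily n b 𝓑 → CrossIntersecting 𝓐 𝓑 →
  LexCross n a b (length 𝓐) (length 𝓑)
lists⇒LexCross n a b 𝓐 𝓑 h (unique₁ , uniform₁) (unique₂ , uniform₂) cross =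
  LexCross-antitone n a b (length≤size 𝓐 unique₁) (length≤size 𝓑 unique₂)
    (Cross⇒LexCross n a b (memberOf 𝓐) (memberOf 𝓑) h
      (λ S → All.lookup uniform₁ ∘ memberOf-sound 𝓐 S) (λ T → All.lookup uniform₂ ∘ memberOf-sound 𝓑 T) meets)
  where
  meets : Cross (memberOf 𝓐) (memberOf 𝓑)
  meets S T p q with cross (memberOf-sound 𝓐 S p) (memberOf-sound 𝓑 T q)
  ... | i , i∈S∩T with x∈p∩q⁻ S T i∈S∩T
  ...   | i∈S , i∈T = i , []=⇒lookup i∈S , []=⇒lookup i∈T

length≤C : ∀ {n} k (𝓐 : List (Subset n)) → IsUniformFamily n k 𝓐 → length 𝓐 ≤ n C k
length≤C k 𝓐 (unique , uniform) = ≤-trans (length≤size 𝓐 unique)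
  (Uniform⇒size-≤ k (λ S → All.lookup uniform ∘ memberOf-sound 𝓐 S))

-- The hypothesis uses r, but the bound holds for every s ≤ r with s < b: the range r ≥ b of the
-- theorem is the case s = b - 1.
LexCross⇒bound : ∀ n a b m r s {x y} → a + m ≡ n → b ≤ m → 1 ≤ r → s ≤ r → s < b →
  x ≤ n C a → y ≤ n C b → LexCross n a b x y →
  ((a < b × r ≤ x) ⊎ (a ≡ b × r ≤ x × r ≤ y) ⊎ (a > b × r ≤ x × n C b + r ≤ y + (b + m) C b)) →
  x + y + suc m C b ≤ n C b + tail m b s
LexCross⇒bound _ a b m r s refl b≤m _ s≤r s<b x≤ y≤ L (inj₁ (a<b , r≤x)) =
  LexCross⇒sum-tail a m b s a<b b≤m s<b (≤-trans s≤r r≤x) x≤ y≤ L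
LexCross⇒bound _ a _ m r s refl b≤m _ s≤r s<b x≤ y≤ L (inj₂ (inj₁ (refl , r≤x , r≤y))) =
  balanced-sum-tail a m s b≤m s<b (≤-trans s≤r r≤x) (≤-trans s≤r r≤y) x≤ y≤ L
LexCross⇒bound n a b m r s {x} {y} e b≤m 1≤r s≤r s<b x≤ y≤ L (inj₂ (inj₂ (b<a , r≤x , big)))
  with m≤n⇒∃[o]m+o≡n (<⇒≤ b<a)
... | k , refl with trans (cong (_+ m) (+-comm k b)) e
...   | e′ with trans (sym (+-assoc k b m)) e′ | +-comm b k
...     | refl | eq = unbalanced-sum-tail k b m r s b≤m 1≤r s≤r s<b r≤x big
            (subst (λ w → x ≤ (k + (b + m)) C w) eq x≤) y≤
            (subst (λ w → LexCross (k + (b + m)) w b x y) eq L)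

tail-pred : ∀ m b → b ≤ m → tail m (suc b) b ≡ suc m
tail-pred m b b≤m = begin-equality
  (suc m ∸ b) C (suc b ∸ b) + b  ≡⟨ cong (λ k → (suc m ∸ b) C k + b) (m+n∸n≡m 1 b) ⟩
  (suc m ∸ b) C 1 + b            ≡⟨ cong (_+ b) (nC1≡n (suc m ∸ b)) ⟩
  suc m ∸ b + b                  ≡⟨ m∸n+n≡m (m≤n⇒m≤1+n b≤m) ⟩
  suc m                          ∎

theorem5p3 : (n a b r : ℕ) → 1 ≤ a → 1 ≤ b → 1 ≤ r → a + b ≤ n →
  (𝓐 𝓑 : List (Subset n)) →
  IsUniformFamily n a 𝓐 → IsUniformFamily n b 𝓑 → CrossIntersecting 𝓐 𝓑 →
  ((a < b × r ≤ length 𝓐)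
    ⊎ (a ≡ b × r ≤ length 𝓐 × r ≤ length 𝓑)
    ⊎ (a > b × r ≤ length 𝓐 × n C b + r ≤ length 𝓑 + (n ∸ a + b) C b)) →
  ((r ≤ b ∸ 1 →
      length 𝓐 + length 𝓑 + (n ∸ a + 1) C b
        ≤ n C b + (n ∸ a ∸ r + 1) C (b ∸ r) + r)
  × (b ≤ r → r ≤ n ∸ a + 1 →
      length 𝓐 + length 𝓑 + (n ∸ a + 1) C b
        ≤ n C b + (n ∸ a + 1)))
theorem5p3 n a (suc b) r 1≤a 1≤b 1≤r a+b≤n 𝓐 𝓑 uniform₁ uniform₂ cross hyp =
    (λ r≤b → begin
      length 𝓐 + length 𝓑 + (m + 1) C suc b          ≡⟨ cong (λ k → length 𝓐 + length 𝓑 + k C suc b) (+-comm m 1) ⟩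
      length 𝓐 + length 𝓑 + suc m C suc b            ≤⟨ bound r ≤-refl (s≤s r≤b) ⟩
      n C suc b + ((suc m ∸ r) C (suc b ∸ r) + r)    ≡⟨ +-assoc (n C suc b) _ r ⟨
      n C suc b + (suc m ∸ r) C (suc b ∸ r) + r      ≡⟨ cong (λ k → n C suc b + k C (suc b ∸ r) + r) (shrink r≤b) ⟩
      n C suc b + (m ∸ r + 1) C (suc b ∸ r) + r      ∎)
  , (λ b<r _ → begin
      length 𝓐 + length 𝓑 + (m + 1) C suc b          ≡⟨ cong (λ k → length 𝓐 + length 𝓑 + k C suc b) (+-comm m 1) ⟩
      length 𝓐 + length 𝓑 + suc m C suc b            ≤⟨ bound b (<⇒≤ b<r) ≤-refl ⟩
      n C suc b + tail m (suc b) b                   ≡⟨ cong (n C suc b +_) (trans (tail-pred m b (<⇒≤ b<m)) (+-comm 1 m)) ⟩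
      n C suc b + (m + 1)                            ∎)
  where
  m = n ∸ a

  b<m : b < m
  b<m = ≤-trans (≤-reflexive (sym (m+n∸m≡n a (suc b)))) (∸-monoˡ-≤ a a+b≤n)

  shrink : r ≤ b → suc m ∸ r ≡ m ∸ r + 1
  shrink r≤b = trans (+-∸-assoc 1 (≤-trans r≤b (<⇒≤ b<m))) (+-comm 1 (m ∸ r))

  bound : ∀ s → s ≤ r → s < suc b → length 𝓐 + length 𝓑 + suc m C suc b ≤ n C suc b + tail m (suc b) s
  bound s s≤r s<b = LexCross⇒bound n a (suc b) m r s (m+[n∸m]≡n (m+n≤o⇒m≤o a a+b≤n)) b<m 1≤r s≤r s<b
    (length≤C a 𝓐 uniform₁) (length≤C (suc b) 𝓑 uniform₂)
    (lists⇒LexCross n a (suc b) 𝓐 𝓑 a+b≤n uniform₁ uniform₂ cross)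
    (subst (λ k → (a < suc b × r ≤ length 𝓐)
        ⊎ (a ≡ suc b × r ≤ length 𝓐 × r ≤ length 𝓑)
        ⊎ (a > suc b × r ≤ length 𝓐 × n C suc b + r ≤ length 𝓑 + k C suc b)) (+-comm m (suc b)) hyp)
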